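{- For every $d\ge 2$, the graph $\mathcal{D}_{2d-2}(\mathbb{Q}^d)$ is connected and has diameter at most $(d-1)2^{d-1}$.
   Context: $\mathbb{Q}^d$ is the unit hypercube graph with vertex set $\{1,2\}^d$, two vertices adjacent iff they differ in exactly one coordinate. A dimer configuration on a graph $G$ is a perfect matching; its edges are dimers. An alternating cycle is a cycle of even length in which every second edge is a dimer; switching it exchanges dimer and non-dimer edges along the cycle. For $\ell\ge 2$, $\mathcal{D}_\ell(G)$ is the graph on dimer configurations of $G$ in which two configurations are adjacent if one is obtained from the other by switching an alternating cycle of length at most $2\ell$. -}

module Defs where

open import Data.Nat using (ℕ; zero; suc; _≤_; _*_; _∸_; _^_)
open import Data.Nat.DivMod using (_mod_)
open import Data.Fin using (Fin; toℕ)
open import Data.Bool using (Bool)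
open import Data.Vec using (Vec; lookup)
open import Data.Product using (Σ; ∃; _×_)
open import Relation.Binary.PropositionalEquality using (_≡_; _≢_)

-- Vertices of the hypercube Q^d: words in {1,2}^d, encoded as Vec Bool d.
Vertex : ℕ → Set
Vertex d = Vec Bool d

Adj : ∀ {d} → Vertex d → Vertex d → Set
Adj {d} u v = Σ (Fin d) λ i → (lookup u i ≢ lookup v i)
  × (∀ j → j ≢ i → lookup u j ≡ lookup v j)

-- A dimer configuration (perfect matching) of Q^d, given by the partner map:
-- every vertex v is matched to exactly one vertex partner v, which is
-- adjacent to v, and the pairing is symmetric.
record Dimer (d : ℕ) : Set where
  field
    partner     : Vertex d → Vertex d
    partner-adj : ∀ v → Adj v (partner v)
    partner-inv : ∀ v → partner (partner v) ≡ v
open Dimer public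

_≈D_ : ∀ {d} → Dimer d → Dimer d → Set
M ≈D N = ∀ v → partner M v ≡ partner N v

next : ∀ {j} → Fin (suc j) → Fin (suc j)
next {j} i = suc (toℕ i) mod (suc j)

-- An alternating cycle of length 2k (k = suc j) for M:
-- a₀ b₀ a₁ b₁ … a_{k-1} b_{k-1} (a₀), all 2k vertices distinct,
-- aᵢ bᵢ a dimer of M and bᵢ a_{i+1} an edge of Q^d.
record AltCycle {d : ℕ} (M : Dimer d) (j : ℕ) : Set where
  field
    a b      : Fin (suc j) → Vertex d
    a-inj    : ∀ i i' → a i ≡ a i' → i ≡ i'
    b-inj    : ∀ i i' → b i ≡ b i' → i ≡ i'
    a≢b      : ∀ i i' → a i ≢ b i'
    dimer    : ∀ i → partner M (a i) ≡ b i
    edge     : ∀ i → Adj (b i) (a (next i))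
open AltCycle public

OnCycle : ∀ {d} {M : Dimer d} {j} → AltCycle M j → Vertex d → Set
OnCycle C v = ∃ λ i → (a C i ≡ v) Data.Sum.⊎ (b C i ≡ v)
  where import Data.Sum

Switched : ∀ {d} (M : Dimer d) {j} → AltCycle M j → Dimer d → Set
Switched M C N = (∀ i → partner N (b C i) ≡ a C (next i))
  × (∀ v → (OnCycle C v → Data.Empty.⊥) → partner N v ≡ partner M v)
  where import Data.Empty

-- adjacency in D_ℓ(Q^d): switch an alternating cycle of length 2k with
-- 2 ≤ k ≤ ℓ (length between 4 and 2ℓ; cycles in a simple graph have
-- length ≥ 3, even ones ≥ 4).
StepD : ∀ {d} → ℕ → Dimer d → Dimer d → Set
StepD ℓ M N = Σ ℕ λ j → (1 ≤ j) × (suc j ≤ ℓ) ×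
  Σ (AltCycle M j) λ C → Switched M C N

data Within {d} (ℓ : ℕ) : ℕ → Dimer d → Dimer d → Set where
  done : ∀ {n M N} → M ≈D N → Within ℓ n M N
  step : ∀ {n M K N} → StepD ℓ M K → Within ℓ n K N → Within ℓ (suc n) M N

module Submission where

open import Defs
open import Algebra.Properties.CommutativeSemigroup using (interchange)
open import Data.Bool using (Bool; true; false; not; _∧_; _∨_; _xor_; if_then_else_)
import Data.Bool.Properties as Bool
open import Data.Empty using (⊥-elim)
open import Data.Fin using (Fin; zero; suc; toℕ; fromℕ; inject₁)
import Data.Fin.Properties as Fin
open import Data.Fin.Relation.Unary.Top using (view; ‵fromℕ; ‵inject₁)
open import Data.Nat using (ℕ; zero; suc; _+_; _*_; _∸_; _^_; _%_; _≤_; _<_; z≤n; s≤s; _≤?_; >-nonZero)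
open import Data.Nat.Combinatorics using (_C_; nCk+nC[k+1]≡[n+1]C[k+1]; k>n⇒nCk≡0; nC1≡n)
open import Data.Nat.DivMod using (m<n⇒m%n≡m; n%n≡0; m%n<n)
open import Data.Nat.Properties hiding (_≟_)
open import Data.Nat.Tactic.RingSolver using (solve-∀)
open import Data.Product using (∃; _×_; _,_; proj₁; proj₂)
open import Data.Sum using (_⊎_; inj₁; inj₂; [_,_]′)
open import Data.Vec using ([]; _∷_; tail; lookup)
import Data.Vec.Properties as Vec
open import Function using (_∘_; Injective)
open import Relation.Nullary using (Dec; yes; no; does; ¬_)
open import Relation.Nullary.Decidable using (dec-true; dec-false)
open import Relation.Binary.PropositionalEquality using (_≡_; _≢_; refl; sym; trans; cong; cong₂; subst; subst₂; module ≡-Reasoning)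

-- Call the first coordinate vertical. If M and N can be cleared of vertical dimers in 2^(d-2)
-- steps each, induction in the two layers gives the bound B(d) = 2 B(d-1) + 2^(d-1).
--
-- Dropping the first coordinate identifies the white (even) and also the black (odd) vertices of
-- Q^d with Q^(d-1) =: Q^n, so a dimer configuration becomes a permutation π of Q^n sending the
-- black end of each dimer to the white one; vertical dimers are the fixed points. Alternating
-- cycles without vertical non-dimer edges are cyclic sequences of distinct points q_i with
-- π(q_i) ~ q_(i+1); switching one through a fixed point u creates no vertical dimer and destroys u.
-- Such a cycle of at most 2n points exists: the sets reachable from u, and those reaching u, in k
-- steps have at least C(n-1,0) + … + C(n-1,k) elements, by a vertex-isoperimetric inequality for
-- open neighbourhoods, so the forward set after n+1 steps meets the backward set after n-1 steps,
-- unless growth has stopped at half the cube; the forward set is then a union of parity classes.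
--
-- It suffices to destroy the vertical dimers over odd points, of which there are at most 2^(n-1):
-- once they are gone, π maps odd points injectively to even ones and so leaves no even fixed point.

private variable
  n m j k ℓ : ℕ

+-interchange : ∀ a b c d → (a + b) + (c + d) ≡ (a + c) + (b + d)
+-interchange = interchange +-commutativeSemigroup

-- Partial sums of binomial coefficients

pascal : ∀ n k → suc n C suc k ≡ n C suc k + n C k
pascal n k = trans (sym (nCk+nC[k+1]≡[n+1]C[k+1] n k)) (+-comm (n C k) (n C suc k))

-- This is (k+1) C(n,k+1) = (n-k) C(n,k) freed of subtraction; induction on n by Pascal's rule.
absorption : ∀ n k → suc k * (n C suc k) + k * (n C k) ≡ n * (n C k)
absorption zero zero = refl
absorption zero (suc k) = cong₂ _+_ (*-zeroʳ (suc (suc k))) (*-zeroʳ (suc k))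
absorption (suc n) zero = trans (+-identityʳ _) (trans (*-identityˡ _) (trans (nC1≡n (suc n)) (sym (*-identityʳ (suc n)))))
absorption (suc n) (suc k) = begin
  suc (suc k) * (suc n C suc (suc k)) + suc k * (suc n C suc k)
    ≡⟨ cong₂ (λ x y → suc (suc k) * x + suc k * y) (pascal n (suc k)) (pascal n k) ⟩
  suc (suc k) * (r + q) + suc k * (q + p)
    ≡⟨ regroup k p q r ⟩
  (suc (suc k) * r + suc k * q) + (suc k * q + k * p) + (q + p)
    ≡⟨ cong₂ (λ x y → x + y + (q + p)) (absorption n (suc k)) (absorption n k) ⟩
  n * q + n * p + (q + p)
    ≡⟨ factor n p q ⟩
  suc n * (q + p)
    ≡⟨ cong (suc n *_) (sym (pascal n k)) ⟩
  suc n * (suc n C suc k) ∎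
  where
  open ≡-Reasoning
  p = n C k
  q = n C suc k
  r = n C suc (suc k)
  regroup : ∀ k p q r → suc (suc k) * (r + q) + suc k * (q + p)
    ≡ (suc (suc k) * r + suc k * q) + (suc k * q + k * p) + (q + p)
  regroup = solve-∀
  factor : ∀ n p q → n * q + n * p + (q + p) ≡ suc n * (q + p)
  factor = solve-∀

-- With y - x = q - p for a known inequality p ≤ q (typically a nonnegative combination of
-- hypotheses), what remains of x ≤ y is a semiring identity.
≤-by : ∀ {x y p q} → p ≤ q → y + p ≡ x + q → x ≤ y
≤-by {x} {y} {p} {q} p≤q eq =
  +-cancelʳ-≤ p x y (≤-trans (+-monoʳ-≤ x p≤q) (≤-reflexive (sym eq)))

-- Two instances of `absorption` give (k+1)(k+2)(qq - pr) = (n+1)pq, which is nonnegative.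
log-concave : ∀ n k → (n C k) * (n C suc (suc k)) ≤ (n C suc k) * (n C suc k)
log-concave n k = *-cancelˡ-≤ (suc k * suc (suc k)) scaled
  where
  p = n C k
  q = n C suc k
  r = n C suc (suc k)
  identity : ∀ k n p q r →
    suc k * suc (suc k) * (q * q)
      + (suc (suc k) * q * (n * p) + suc k * p * (suc (suc k) * r + suc k * q))
    ≡ suc k * suc (suc k) * (p * r)
      + (suc (suc k) * q * (suc k * q + k * p) + suc k * p * (n * q) + suc n * (q * p))
  identity = solve-∀
  scaled : suc k * suc (suc k) * (p * r) ≤ suc k * suc (suc k) * (q * q)
  scaled = ≤-by
    (≤-trans
      (≤-reflexive (cong₂ (λ x y → suc (suc k) * q * x + suc k * p * y)
        (sym (absorption n k)) (absorption n (suc k))))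
      (m≤m+n _ (suc n * (q * p))))
    (identity k n p q r)

partialSum : ℕ → ℕ → ℕ
partialSum n zero    = 0
partialSum n (suc j) = partialSum n j + n C j

partialSum-pascal : ∀ n j →
  partialSum (suc n) (suc j) ≡ partialSum n (suc j) + partialSum n j
partialSum-pascal n zero    = refl
partialSum-pascal n (suc j) = trans
  (cong₂ _+_ (partialSum-pascal n j) (pascal n j))
  (+-interchange (partialSum n (suc j)) (partialSum n j) (n C suc j) (n C j))

partialSum-one : ∀ j → partialSum 0 (suc j) ≡ 1
partialSum-one zero    = refl
partialSum-one (suc j) = trans (+-identityʳ _) (partialSum-one j)

partialSum-full : ∀ n → partialSum n (suc n) ≡ 2 ^ n
partialSum-full zero    = refl
partialSum-full (suc n) = begin
  partialSum (suc n) (suc (suc n))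
    ≡⟨ partialSum-pascal n (suc n) ⟩
  partialSum n (suc n) + n C suc n + partialSum n (suc n)
    ≡⟨ cong₂ (λ x y → x + y + x) (partialSum-full n) (k>n⇒nCk≡0 (n<1+n n)) ⟩
  2 ^ n + 0 + 2 ^ n
    ≡⟨ trans (cong (_+ 2 ^ n) (+-identityʳ (2 ^ n))) (cong (2 ^ n +_) (sym (+-identityʳ (2 ^ n)))) ⟩
  2 ^ suc n ∎
  where open ≡-Reasoning

-- D times the point at parameter T/D of the segment from partialSum n j to partialSum n (suc j).
chain : ℕ → ℕ → ℕ → ℕ → ℕ
chain n D T j = D * partialSum n j + T * (n C j)

-- Pascal's rule passes to interpolated points. It splits a threshold in dimension n+1 into
-- thresholds for the two halves of the cube.
chain-pascal : ∀ n D T j →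
  chain (suc n) D T (suc j) ≡ chain n D T (suc j) + chain n D T j
chain-pascal n D T j = trans
  (cong₂ (λ x y → D * x + T * y) (partialSum-pascal n j) (pascal n j))
  (distrib D T (partialSum n (suc j)) (partialSum n j) (n C suc j) (n C j))
  where
  distrib : ∀ D T a b x y → D * (a + b) + T * (x + y) ≡ (D * a + T * x) + (D * b + T * y)
  distrib = solve-∀

-- The size t of a neighbourhood lies above the piecewise linear function through the points
-- (partialSum n j , partialSum n (suc j)), evaluated at s. The breakpoints alone do not survive
-- the induction on the dimension. That function is concave because binomials are log-concave.
Expands : ℕ → ℕ → ℕ → Set
Expands n s t = ∀ D T j → T ≤ D → chain n D T j ≤ D * s → chain n D T (suc j) ≤ D * t

-- Taking `D` = C(n,j) and `T` = `α` places the interpolated point exactly at s, so the bound is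
-- evaluated there without division.
interpolate : ∀ {n s t} → Expands n s t → ∀ j α → α ≤ n C j → s ≡ partialSum n j + α →
  (n C j) * (partialSum n j + n C j) + α * (n C suc j) ≤ (n C j) * t
interpolate {n} e j α α≤ refl = e (n C j) α j α≤
  (≤-reflexive (identity (n C j) (partialSum n j) α))
  where
  identity : ∀ p G α → p * G + α * p ≡ p * (G + α)
  identity = solve-∀

-- Let F be the concave function with F(G) = G+p and slopes q/p on [G, G+p], r/q on [G+p, G+p+q].
-- With x = G+p+(T/D)q and y = G+(T/D)p, each lemma derives F(x)+F(y) ≤ na+nb from x+y ≤ a+b, where
-- na ≥ F(a) and nb ≥ F(b). The cases differ in the segments that hold a and b.
module _ {D T G p q r na nb : ℕ} (concave : p * r ≤ q * q) where

  adjacent-segments : ∀ {α β} → 0 < p → 0 < q →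
    D * (G + p + α) < D * (G + p) + T * q →
    D * (G + p) + T * q + (D * G + T * p) ≤ D * (G + p + α) + D * (G + β) →
    q * (G + p + q) + α * r ≤ q * na →
    p * (G + p) + β * q ≤ p * nb →
    D * (G + p + q) + T * r + (D * (G + p) + T * q) ≤ D * na + D * nb
  adjacent-segments {α} {β} 0<p 0<q below sum ha hb =
    *-cancelˡ-≤ (p * q) {{m*n≢0 p q {{>-nonZero 0<p}} {{>-nonZero 0<q}}}}
      (≤-by
        (+-mono-≤ (+-mono-≤ (+-mono-≤ (*-monoʳ-≤ (p * D) ha) (*-monoʳ-≤ (q * D) hb))
                            (*-monoʳ-≤ (q * q) sum))
                  (+-mono-≤ (*-monoʳ-≤ δ concave)
                    (+-mono-≤ (≤-reflexive (cong (p * r *_) δ-eq)) (≤-reflexive (cong (q * q *_) (sym δ-eq))))))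
        (identity D T G p q r na nb α β δ))
    where
    -- `δ` is D(x - a). As b - y ≥ x - a, the gain (b - y)q/p from y to b outweighs the loss (x -
    -- a)r/q from x down to a.
    δ = T * q ∸ D * α
    δ-eq : T * q ≡ D * α + δ
    δ-eq = sym (m+[n∸m]≡n (+-cancelˡ-≤ (D * (G + p)) _ _
      (≤-trans (≤-reflexive (sym (*-distribˡ-+ D (G + p) α))) (<⇒≤ below))))
    identity : ∀ D T G p q r na nb α β δ →
      p * q * (D * na + D * nb)
        + (p * D * (q * (G + p + q) + α * r) + q * D * (p * (G + p) + β * q)
           + q * q * (D * (G + p) + T * q + (D * G + T * p))
           + (δ * (p * r) + (p * r * (T * q) + q * q * (D * α + δ))))
      ≡ p * q * (D * (G + p + q) + T * r + (D * (G + p) + T * q))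
        + (p * D * (q * na) + q * D * (p * nb)
           + q * q * (D * (G + p + α) + D * (G + β))
           + (δ * (q * q) + (p * r * (D * α + δ) + q * q * (T * q))))
    identity = solve-∀

  -- By concavity the line through the upper segment lies above F at y, so it is enough to compare
  -- values on that line.
  upper-segment : ∀ {α β} → 0 < q → T ≤ D →
    D * (G + p) + T * q + (D * G + T * p) ≤ D * (G + p + α) + D * (G + p + β) →
    q * (G + p + q) + α * r ≤ q * na →
    q * (G + p + q) + β * r ≤ q * nb →
    D * (G + p + q) + T * r + (D * (G + p) + T * q) ≤ D * na + D * nb
  upper-segment {α} {β} 0<q T≤D sum ha hb =
    *-cancelˡ-≤ q {{>-nonZero 0<q}}
      (≤-by
        (+-mono-≤ (+-mono-≤ (+-mono-≤ (*-monoʳ-≤ D ha) (*-monoʳ-≤ D hb)) (*-monoʳ-≤ r sum))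
                  (+-mono-≤ (*-monoʳ-≤ e concave)
                    (+-mono-≤ (≤-reflexive (cong (q * q *_) (sym e-eq))) (≤-reflexive (cong (p * r *_) e-eq)))))
        (identity D T G p q r na nb α β e))
    where
    e = D ∸ T
    e-eq : D ≡ T + e
    e-eq = sym (m+[n∸m]≡n T≤D)
    identity : ∀ D T G p q r na nb α β e →
      q * (D * na + D * nb)
        + (D * (q * (G + p + q) + α * r) + D * (q * (G + p + q) + β * r)
           + r * (D * (G + p) + T * q + (D * G + T * p))
           + (e * (p * r) + (q * q * (T + e) + p * r * D)))
      ≡ q * (D * (G + p + q) + T * r + (D * (G + p) + T * q))
        + (D * (q * na) + D * (q * nb)
           + r * (D * (G + p + α) + D * (G + p + β))
           + (e * (q * q) + (q * q * D + p * r * (T + e))))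
    identity = solve-∀

  -- Symmetrically, the line through the lower segment lies above F at x.
  lower-segment : ∀ {α β} → 0 < p →
    D * (G + p) + T * q + (D * G + T * p) ≤ D * (G + α) + D * (G + β) →
    p * (G + p) + α * q ≤ p * na →
    p * (G + p) + β * q ≤ p * nb →
    D * (G + p + q) + T * r + (D * (G + p) + T * q) ≤ D * na + D * nb
  lower-segment {α} {β} 0<p sum ha hb =
    *-cancelˡ-≤ p {{>-nonZero 0<p}}
      (≤-by
        (+-mono-≤ (+-mono-≤ (+-mono-≤ (*-monoʳ-≤ D ha) (*-monoʳ-≤ D hb)) (*-monoʳ-≤ q sum))
                  (*-monoʳ-≤ T concave))
        (identity D T G p q r na nb α β))
    where
    identity : ∀ D T G p q r na nb α β →
      p * (D * na + D * nb)
        + (D * (p * (G + p) + α * q) + D * (p * (G + p) + β * q)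
           + q * (D * (G + p) + T * q + (D * G + T * p)) + T * (p * r))
      ≡ p * (D * (G + p + q) + T * r + (D * (G + p) + T * q))
        + (D * (p * na) + D * (p * nb)
           + q * (D * (G + α) + D * (G + β)) + T * (q * q))
    identity = solve-∀

-- Here a and b are the sizes of the two halves of a set, na and nb those of their neighbourhoods
-- within the half; in the smaller half one may count a copy of the larger half in place of nb.
module _ {n D T a b na nb : ℕ} (T≤D : T ≤ D) (b≤a : b ≤ a)
         (ea : Expands n a na) (eb : 0 < b → Expands n b nb) where

  expand-pair : ∀ j → chain n D T (suc j) + chain n D T j ≤ D * a + D * b →
    chain n D T (suc (suc j)) + chain n D T (suc j) ≤ D * na + D * a
    ⊎ chain n D T (suc (suc j)) + chain n D T (suc j) ≤ D * na + D * nb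
  -- Let x and y be the thresholds at j+1 and j divided by `D`, so F(y) = x. If x ≤ a, then F(x) ≤
  -- na and F(y) = x ≤ a. Otherwise y < b ≤ a < x, and a concave function has the larger sum at the
  -- inner pair.
  expand-pair j sum with chain n D T (suc j) ≤? D * a
  ... | yes reached = inj₁ (+-mono-≤ (ea D T (suc j) T≤D reached) reached)
  ... | no unreached = inj₂ both
    where
    G = partialSum n j
    p = n C j
    q = n C suc j
    r = n C suc (suc j)

    a-below : D * a < D * (G + p) + T * q
    a-below = ≰⇒> unreached

    b-above : D * G + T * p < D * b
    b-above = ≰⇒> (λ le → <⇒≱ (+-mono-<-≤ a-below le) sum)

    G<b : G < b
    G<b = *-cancelˡ-< D G b (≤-<-trans (m≤m+n (D * G) (T * p)) b-above)

    a<top : a < G + p + q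
    a<top = *-cancelˡ-< D a (G + p + q)
      (<-≤-trans a-below (≤-trans (+-monoʳ-≤ (D * (G + p)) (*-monoˡ-≤ q T≤D))
        (≤-reflexive (sym (*-distribˡ-+ D (G + p) q)))))

    eb′ : Expands n b nb
    eb′ = eb (≤-<-trans z≤n G<b)

    split : ∀ {x y} → x ≤ y → ∃ λ α → y ≡ x + α
    split {x} {y} x≤y = y ∸ x , sym (m+[n∸m]≡n x≤y)

    concave : p * r ≤ q * q
    concave = log-concave n j

    both : D * (G + p + q) + T * r + (D * (G + p) + T * q) ≤ D * na + D * nb
    -- Both sizes lie between `G` and `G + p + q`, so only the breakpoint `G + p` can separate them;
    -- b ≤ a leaves three cases.
    both with G + p ≤? a | G + p ≤? b
    ... | no  a<G+p | _ with split (≤-trans (<⇒≤ G<b) b≤a) | split (<⇒≤ G<b)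
    ...   | α , refl | β , refl =
      lower-segment {D} {T} {G} {p} {q} {r} concave 0<p sum
        (interpolate ea j α (<⇒≤ α<p) refl)
        (interpolate eb′ j β (≤-trans (+-cancelˡ-≤ G β α b≤a) (<⇒≤ α<p)) refl)
      where
      α<p : α < p
      α<p = +-cancelˡ-< G α p (≰⇒> a<G+p)
      0<p : 0 < p
      0<p = ≤-<-trans z≤n α<p
    both | yes G+p≤a | yes G+p≤b with split G+p≤a | split G+p≤b
    ...   | α , refl | β , refl =
      upper-segment {D} {T} {G} {p} {q} {r} concave 0<q T≤D sum
        (interpolate ea (suc j) α (<⇒≤ α<q) refl)
        (interpolate eb′ (suc j) β (≤-trans (+-cancelˡ-≤ (G + p) β α b≤a) (<⇒≤ α<q)) refl)
      where
      α<q : α < q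
      α<q = +-cancelˡ-< (G + p) α q a<top
      0<q : 0 < q
      0<q = ≤-<-trans z≤n α<q
    both | yes G+p≤a | no b<G+p with split G+p≤a | split (<⇒≤ G<b)
    ...   | α , refl | β , refl =
      adjacent-segments {D} {T} {G} {p} {q} {r} concave 0<p 0<q a-below sum
        (interpolate ea (suc j) α (<⇒≤ α<q) refl)
        (interpolate eb′ j β (<⇒≤ β<p) refl)
      where
      α<q : α < q
      α<q = +-cancelˡ-< (G + p) α q a<top
      0<q : 0 < q
      0<q = ≤-<-trans z≤n α<q
      β<p : β < p
      β<p = +-cancelˡ-< G β p (≰⇒> b<G+p)
      0<p : 0 < p
      0<p = ≤-<-trans z≤n β<p

-- Finite sets of vertices and their neighbourhoods

VSet : ℕ → Set
VSet n = Vertex n → Bool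

infix 4 _∈_ _∉_ _⊆_ _≟_

_∈_ _∉_ : Vertex n → VSet n → Set
v ∈ S = S v ≡ true
v ∉ S = S v ≡ false

_⊆_ : VSet n → VSet n → Set
S ⊆ T = ∀ v → v ∈ S → v ∈ T

_≟_ : (u v : Vertex n) → Dec (u ≡ v)
_≟_ = Vec.≡-dec Bool._≟_

true-false : ∀ {A : Set} {x} → x ≡ true → x ≡ false → A
true-false refl ()

decided : ∀ {A : Set} (a? : Dec A) → does a? ≡ true → A
decided (yes a) _ = a

∨-split : ∀ x {y} → x ∨ y ≡ true → x ≡ true ⊎ y ≡ true
∨-split true  _ = inj₁ refl
∨-split false e = inj₂ e

∧-split : ∀ x {y} → x ∧ y ≡ true → x ≡ true × y ≡ true
∧-split true e = refl , e

slice : Bool → VSet (suc n) → VSet n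
slice x S v = S (x ∷ v)

card : VSet n → ℕ
card {zero}  S = if S [] then 1 else 0
card {suc n} S = card (slice true S) + card (slice false S)

inhabited? : (S : VSet n) → (∃ λ v → v ∈ S) ⊎ (∀ v → v ∉ S)
inhabited? {zero} S with S [] in eq
... | true  = inj₁ ([] , eq)
... | false = inj₂ (λ { [] → eq })
inhabited? {suc n} S with inhabited? (slice true S) | inhabited? (slice false S)
... | inj₁ (v , v∈) | _ = inj₁ (true ∷ v , v∈)
... | inj₂ _ | inj₁ (v , v∈) = inj₁ (false ∷ v , v∈)
... | inj₂ ∉t | inj₂ ∉f = inj₂ (λ { (true ∷ v) → ∉t v ; (false ∷ v) → ∉f v })

card-∅ : (S : VSet n) → (∀ v → v ∉ S) → card S ≡ 0
card-∅ {zero}  S ∉S rewrite ∉S [] = refl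
card-∅ {suc n} S ∉S = cong₂ _+_ (card-∅ _ (λ v → ∉S (true ∷ v))) (card-∅ _ (λ v → ∉S (false ∷ v)))

card-∪ : (S T U : VSet n) → (∀ v → v ∈ S → v ∈ T ⊎ v ∈ U) → card S ≤ card T + card U
card-∪ {zero} S T U cover with S [] in eq
... | false = z≤n
... | true with cover [] eq
...   | inj₁ e rewrite e = s≤s z≤n
...   | inj₂ e rewrite e = m≤n+m 1 _
card-∪ {suc n} S T U cover = ≤-trans
  (+-mono-≤ (card-∪ _ (slice true T) (slice true U) (λ v → cover (true ∷ v)))
            (card-∪ _ (slice false T) (slice false U) (λ v → cover (false ∷ v))))
  (≤-reflexive (+-interchange (card (slice true T)) _ (card (slice false T)) _))

card-mono : (S T : VSet n) → S ⊆ T → card S ≤ card T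
card-mono S T S⊆T = ≤-trans (card-∪ S T ∅ (λ v → inj₁ ∘ S⊆T v))
  (≤-reflexive (trans (cong (card T +_) (card-∅ ∅ (λ _ → refl))) (+-identityʳ _)))
  where
  ∅ : VSet _
  ∅ _ = false

card-strict : (S T : VSet n) → S ⊆ T → ∀ {v} → v ∉ S → v ∈ T → card S < card T
card-strict {zero} S T _ {[]} v∉S v∈T rewrite v∉S | v∈T = s≤s z≤n
card-strict {suc n} S T S⊆T {true ∷ v} v∉S v∈T = +-mono-<-≤
  (card-strict _ (slice true T) (λ w → S⊆T (true ∷ w)) v∉S v∈T)
  (card-mono _ (slice false T) (λ w → S⊆T (false ∷ w)))
card-strict {suc n} S T S⊆T {false ∷ v} v∉S v∈T = +-mono-≤-<
  (card-mono _ (slice true T) (λ w → S⊆T (true ∷ w)))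
  (card-strict _ (slice false T) (λ w → S⊆T (false ∷ w)) v∉S v∈T)

⊆-card⇒≗ : (S T : VSet n) → S ⊆ T → card T ≤ card S → ∀ v → S v ≡ T v
⊆-card⇒≗ S T S⊆T T≤S v with S v in eqS | T v in eqT
... | true  | true  = refl
... | false | false = refl
... | true  | false = trans (sym (S⊆T v eqS)) eqT
... | false | true  = ⊥-elim (<⇒≱ (card-strict S T S⊆T eqS eqT) T≤S)

inhabited⇒0<card : (S : VSet n) → ∀ {v} → v ∈ S → 0 < card S
inhabited⇒0<card S v∈S = ≤-<-trans z≤n (card-strict (λ _ → false) S (λ _ ()) refl v∈S)

0<card⇒inhabited : (S : VSet n) → 0 < card S → ∃ λ v → v ∈ S
0<card⇒inhabited S 0<S with inhabited? S
... | inj₁ found = found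
... | inj₂ ∉S = ⊥-elim (<⇒≢ 0<S (sym (card-∅ S ∉S)))

⁅_⁆ : Vertex n → VSet n
⁅ v ⁆ w = does (w ≟ v)

card-⁅⁆ : (v : Vertex n) → card ⁅ v ⁆ ≡ 1
card-⁅⁆ []          = refl
card-⁅⁆ (true ∷ v)  = cong₂ _+_ (card-⁅⁆ v) (card-∅ (slice false ⁅ true ∷ v ⁆) (λ _ → refl))
card-⁅⁆ (false ∷ v) = cong₂ _+_ (card-∅ (slice true ⁅ false ∷ v ⁆) (λ _ → refl)) (card-⁅⁆ v)

infixl 6 _∖_

_∖_ : VSet n → Vertex n → VSet n
(S ∖ v) w = S w ∧ not (does (w ≟ v))

∖-⊆ : (S : VSet n) (v : Vertex n) → (S ∖ v) ⊆ S
∖-⊆ S v w w∈ = proj₁ (∧-split (S w) w∈)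

∉-∖ : (S : VSet n) (v : Vertex n) → v ∉ (S ∖ v)
∉-∖ S v rewrite dec-true (v ≟ v) refl = Bool.∧-zeroʳ (S v)

∈-∖ : (S : VSet n) {v w : Vertex n} → w ∈ S → w ≢ v → w ∈ (S ∖ v)
∈-∖ S {v} {w} w∈S w≢v rewrite w∈S | dec-false (w ≟ v) w≢v = refl

∖-≢ : (S : VSet n) {v w : Vertex n} → w ∈ (S ∖ v) → w ≢ v
∖-≢ S {v} w∈ refl = true-false w∈ (∉-∖ S v)

card-∖ : (S : VSet n) (v : Vertex n) → card S ≤ suc (card (S ∖ v))
card-∖ S v = subst (λ k → card S ≤ k + card (S ∖ v)) (card-⁅⁆ v) (card-∪ S ⁅ v ⁆ (S ∖ v) cover)
  where
  cover : ∀ w → w ∈ S → w ∈ ⁅ v ⁆ ⊎ w ∈ (S ∖ v)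
  cover w w∈S with w ≟ v
  ... | yes _  = inj₁ refl
  ... | no w≢v = inj₂ (cong (_∧ true) w∈S)

card-injection : (S T : VSet n) (f : Vertex n → Vertex n) → Injective _≡_ _≡_ f →
  (∀ v → v ∈ S → f v ∈ T) → card S ≤ card T
card-injection {n} S T f f-inj maps = go (card S) S T maps ≤-refl
  where
  go : ∀ k (S T : VSet n) → (∀ v → v ∈ S → f v ∈ T) → card S ≤ k → card S ≤ card T
  go zero S T maps S≤0 = ≤-trans S≤0 z≤n
  go (suc k) S T maps S≤k with inhabited? S
  ... | inj₂ ∉S = ≤-trans (≤-reflexive (card-∅ S ∉S)) z≤n
  ... | inj₁ (v , v∈S) = begin
    card S               ≤⟨ card-∖ S v ⟩
    suc (card (S ∖ v))   ≤⟨ s≤s (go k (S ∖ v) (T ∖ f v) maps′ S∖v≤k) ⟩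
    suc (card (T ∖ f v)) ≤⟨ card-strict (T ∖ f v) T (∖-⊆ T (f v)) (∉-∖ T (f v)) (maps v v∈S) ⟩
    card T               ∎
    where
    open ≤-Reasoning
    maps′ : ∀ w → w ∈ (S ∖ v) → f w ∈ (T ∖ f v)
    maps′ w w∈ = ∈-∖ T (maps w (∖-⊆ S v w w∈)) (∖-≢ S w∈ ∘ f-inj)
    S∖v≤k : card (S ∖ v) ≤ k
    S∖v≤k = ≤-pred (≤-trans (card-strict (S ∖ v) S (∖-⊆ S v) (∉-∖ S v) v∈S) S≤k)

card-disjoint : (S T : VSet n) → (∀ v → S v ∧ T v ≡ false) → card S + card T ≤ 2 ^ n
card-disjoint {zero} S T disjoint with S [] | T [] | disjoint []
... | true  | false | _ = ≤-refl
... | false | true  | _ = ≤-refl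
... | false | false | _ = z≤n
card-disjoint {suc n} S T disjoint = begin
  card S + card T ≡⟨ +-interchange (card (slice true S)) _ (card (slice true T)) _ ⟩
  card (slice true S) + card (slice true T) + (card (slice false S) + card (slice false T))
    ≤⟨ +-mono-≤ (card-disjoint _ (slice true T) (λ v → disjoint (true ∷ v)))
                (card-disjoint _ (slice false T) (λ v → disjoint (false ∷ v))) ⟩
  2 ^ n + 2 ^ n ≡⟨ cong (2 ^ n +_) (sym (+-identityʳ (2 ^ n))) ⟩
  2 ^ suc n ∎
  where
  open ≤-Reasoning

meet? : (S T : VSet n) → (∃ λ v → v ∈ S × v ∈ T) ⊎ card S + card T ≤ 2 ^ n
meet? S T with inhabited? (λ v → S v ∧ T v)
... | inj₁ (v , v∈) = inj₁ (v , ∧-split (S v) v∈)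
... | inj₂ disjoint = inj₂ (card-disjoint S T disjoint)

-- Open neighbourhoods and their growth

nbhd : VSet n → VSet n
nbhd S []      = false
nbhd S (x ∷ v) = S (not x ∷ v) ∨ nbhd (slice x S) v

parity : Vertex n → Bool
parity []      = false
parity (x ∷ v) = x xor parity v

nbhd-opposite : ∀ x (S : VSet (suc n)) → card (slice (not x) S) ≤ card (slice x (nbhd S))
nbhd-opposite x S = card-mono (slice (not x) S) (slice x (nbhd S))
  (λ v v∈ → cong (_∨ nbhd (slice x S) v) v∈)

nbhd-slice : ∀ x (S : VSet (suc n)) → card (nbhd (slice x S)) ≤ card (slice x (nbhd S))
nbhd-slice x S = card-mono (nbhd (slice x S)) (slice x (nbhd S))
  (λ v v∈ → trans (cong (S (not x ∷ v) ∨_) v∈) (Bool.∨-zeroʳ _))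

card≤card-nbhd : (S : VSet (suc n)) → card S ≤ card (nbhd S)
card≤card-nbhd S = ≤-trans (≤-reflexive (+-comm (card (slice true S)) _))
  (+-mono-≤ (nbhd-opposite true S) (nbhd-opposite false S))

-- Induction on the dimension: each half of `nbhd S` contains the neighbourhood of the same half of
-- S and a copy of the other half. The binomials are those of n rather than n+1 because S may lie in
-- one parity class, which has 2^n points.
nbhd-expands : (S : VSet (suc n)) → 0 < card S → Expands n (card S) (card (nbhd S))
nbhd-expands {zero} S 0<S D T j T≤D _ = begin
  D * partialSum 0 (suc j) + T * (0 C suc j)
    ≡⟨ cong₂ (λ x y → D * x + T * y) (partialSum-one j) (k>n⇒nCk≡0 {0} {suc j} (s≤s z≤n)) ⟩
  D * 1 + T * 0    ≡⟨ trans (cong (D * 1 +_) (*-zeroʳ T)) (+-identityʳ (D * 1)) ⟩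
  D * 1            ≤⟨ *-monoʳ-≤ D (≤-trans 0<S (card≤card-nbhd S)) ⟩
  D * card (nbhd S) ∎
  where open ≤-Reasoning
nbhd-expands {suc n} S 0<S = expands
  where
  N : ℕ
  N = card (nbhd S)

  half : Bool → ℕ
  half x = card (slice x S)

  halves : ∀ x → half x + half (not x) ≡ card S
  halves true  = refl
  halves false = +-comm (half false) (half true)

  N-halves : ∀ x → card (slice x (nbhd S)) + card (slice (not x) (nbhd S)) ≡ N
  N-halves true  = refl
  N-halves false = +-comm (card (slice false (nbhd S))) _

  larger : ∃ λ x → half (not x) ≤ half x
  larger with ≤-total (half false) (half true)
  ... | inj₁ le = true , le
  ... | inj₂ le = false , le

  expands : Expands (suc n) (card S) N
  expands D T j T≤D reach = ≤-trans (bound j reach)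
      (≤-trans (≤-reflexive (sym (*-distribˡ-+ D _ _))) (*-monoʳ-≤ D (≤-reflexive (N-halves x))))
    where
    x : Bool
    x = proj₁ larger

    y : Bool
    y = not x

    0<half : 0 < half x
    0<half = n≢0⇒n>0 (λ half≡0 → <⇒≱ 0<S (≤-trans (≤-reflexive (sym (halves x)))
      (+-mono-≤ (≤-reflexive half≡0) (≤-trans (proj₂ larger) (≤-reflexive half≡0)))))

    ea : Expands n (half x) (card (nbhd (slice x S)))
    ea = nbhd-expands (slice x S) 0<half

    opposite : half x ≤ card (slice y (nbhd S))
    opposite = subst (λ z → half z ≤ card (slice y (nbhd S))) (Bool.not-involutive x) (nbhd-opposite y S)

    using-larger : D * card (nbhd (slice x S)) + D * half x
      ≤ D * card (slice x (nbhd S)) + D * card (slice y (nbhd S))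
    using-larger = +-mono-≤ (*-monoʳ-≤ D (nbhd-slice x S)) (*-monoʳ-≤ D opposite)

    using-both : D * card (nbhd (slice x S)) + D * card (nbhd (slice y S))
      ≤ D * card (slice x (nbhd S)) + D * card (slice y (nbhd S))
    using-both = +-mono-≤ (*-monoʳ-≤ D (nbhd-slice x S)) (*-monoʳ-≤ D (nbhd-slice y S))

    bound : ∀ j → chain (suc n) D T j ≤ D * card S → chain (suc n) D T (suc j)
      ≤ D * card (slice x (nbhd S)) + D * card (slice y (nbhd S))
    -- The lower threshold is T/D ≤ 1 here, which the nonempty larger half already reaches.
    bound zero _ = ≤-trans (≤-reflexive (chain-pascal n D T 0))
      (≤-trans (+-mono-≤ (ea D T 0 T≤D start) start) using-larger)
      where
      start : chain n D T 0 ≤ D * half x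
      start = ≤-trans (≤-reflexive (trans (cong (_+ T * 1) (*-zeroʳ D)) (*-identityʳ T)))
        (≤-trans T≤D (m≤m*n D (half x) {{>-nonZero 0<half}}))
    bound (suc j) reach = ≤-trans (≤-reflexive (chain-pascal n D T (suc j)))
      ([ (λ le → ≤-trans le using-larger) , (λ le → ≤-trans le using-both) ]′
        (expand-pair T≤D (proj₂ larger) ea (nbhd-expands (slice y S)) j
          (≤-trans (≤-reflexive (sym (chain-pascal n D T j)))
            (≤-trans reach (≤-reflexive (trans (cong (D *_) (sym (halves x))) (*-distribˡ-+ D _ _)))))))

-- The case D = 1, T = 0: the bound at its breakpoints, the form that the growth of reachable sets
-- needs.
nbhd-growth : (S : VSet (suc n)) → 0 < card S → ∀ j →
  partialSum n j ≤ card S → partialSum n (suc j) ≤ card (nbhd S)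
nbhd-growth {n} S 0<S j reach = subst₂ _≤_ (unit (suc j)) (*-identityˡ _)
  (nbhd-expands S 0<S 1 0 j z≤n (subst₂ _≤_ (sym (unit j)) (sym (*-identityˡ _)) reach))
  where
  unit : ∀ j → chain n 1 0 j ≡ partialSum n j
  unit j = trans (+-identityʳ _) (*-identityˡ _)

-- If taking neighbours does not enlarge S, every coordinate flip maps S onto nbhd S,
-- so S is invariant under double flips.
nbhd-equality : (S : VSet (suc n)) → card (nbhd S) ≤ card S →
  ∃ λ (h : Bool → Bool) → (∀ v → S v ≡ h (parity v)) × (∀ v → nbhd S v ≡ h (not (parity v)))
nbhd-equality {zero} S _ = (λ x → S (x ∷ [])) , on-S , on-N
  where
  on-S : ∀ v → S v ≡ S (parity v ∷ [])
  on-S (true  ∷ []) = refl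
  on-S (false ∷ []) = refl
  on-N : ∀ v → nbhd S v ≡ S (not (parity v) ∷ [])
  on-N (true  ∷ []) = Bool.∨-identityʳ _
  on-N (false ∷ []) = Bool.∨-identityʳ _
nbhd-equality {suc n} S N≤S = h , on-S , on-N
  where
  opposite⊆ : ∀ x → slice (not x) S ⊆ slice x (nbhd S)
  opposite⊆ x v v∈ = cong (_∨ nbhd (slice x S) v) v∈

  slice-card : ∀ x → card (slice x (nbhd S)) ≤ card (slice (not x) S)
  slice-card true = +-cancelʳ-≤ (card (slice true S)) _ _ (begin
    card (slice true (nbhd S)) + card (slice true S) ≤⟨ +-monoʳ-≤ (card (slice true (nbhd S))) (nbhd-opposite false S) ⟩
    card (nbhd S) ≤⟨ N≤S ⟩
    card S ≡⟨ +-comm (card (slice true S)) _ ⟩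
    card (slice false S) + card (slice true S) ∎)
    where open ≤-Reasoning
  slice-card false = +-cancelʳ-≤ (card (slice false S)) _ _ (begin
    card (slice false (nbhd S)) + card (slice false S) ≤⟨ +-monoʳ-≤ (card (slice false (nbhd S))) (nbhd-opposite true S) ⟩
    card (slice false (nbhd S)) + card (slice true (nbhd S)) ≡⟨ +-comm (card (slice false (nbhd S))) _ ⟩
    card (nbhd S) ≤⟨ N≤S ⟩
    card S ∎)
    where open ≤-Reasoning

  N-slice : ∀ x v → S (not x ∷ v) ≡ nbhd S (x ∷ v)
  N-slice x = ⊆-card⇒≗ (slice (not x) S) (slice x (nbhd S)) (opposite⊆ x) (slice-card x)

  within : ∀ x → nbhd (slice x S) ⊆ slice (not x) S
  within x v v∈ = trans (N-slice x v)
    (trans (cong (S (not x ∷ v) ∨_) v∈) (Bool.∨-zeroʳ _))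

  within-card : ∀ x → card (nbhd (slice x S)) ≤ card (slice (not x) S)
  within-card x = card-mono _ (slice (not x) S) (within x)

  half : ∀ x → ∃ λ (h : Bool → Bool) →
    (∀ v → slice x S v ≡ h (parity v)) × (∀ v → nbhd (slice x S) v ≡ h (not (parity v)))
  -- With y = `not x`, the sizes close up in a circle, |N(S_x)| ≤ |S_y| ≤ |N(S_y)| ≤ |S_x|, so the
  -- induction hypothesis applies to each half.
  half x = nbhd-equality (slice x S) (≤-trans (within-card x)
    (≤-trans (card≤card-nbhd (slice (not x) S)) (subst (λ z → card (nbhd (slice (not x) S)) ≤ card (slice z S)) (Bool.not-involutive x) (within-card (not x)))))

  h : Bool → Bool
  h = proj₁ (half false)

  onto : ∀ v → nbhd (slice false S) v ≡ S (true ∷ v)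
  onto = ⊆-card⇒≗ _ (slice true S) (within false)
    (≤-trans (card≤card-nbhd (slice true S))
      (≤-trans (within-card true) (card≤card-nbhd (slice false S))))

  on-S : ∀ v → S v ≡ h (parity v)
  on-S (false ∷ v) = proj₁ (proj₂ (half false)) v
  on-S (true  ∷ v) = trans (sym (onto v)) (proj₂ (proj₂ (half false)) v)

  on-N : ∀ v → nbhd S v ≡ h (not (parity v))
  on-N (x ∷ v) = trans (sym (N-slice x v)) (trans (on-S (not x ∷ v)) (cong h (sym (Bool.not-distribˡ-xor x (parity v)))))

-- Switching

lookup-extensional : (u v : Vertex n) → (∀ i → lookup u i ≡ lookup v i) → u ≡ v
lookup-extensional []      []      _  = refl
lookup-extensional (x ∷ u) (y ∷ v) eq = cong₂ _∷_ (eq zero) (lookup-extensional u v (eq ∘ suc))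

Adj-sym : {u v : Vertex n} → Adj u v → Adj v u
Adj-sym (i , u≢v , same) = i , u≢v ∘ sym , λ k k≢i → sym (same k k≢i)

Adj-flip : ∀ {x y} (v : Vertex n) → x ≢ y → Adj (x ∷ v) (y ∷ v)
Adj-flip v x≢y = zero , x≢y , λ { zero 0≢0 → ⊥-elim (0≢0 refl) ; (suc _) _ → refl }

Adj-cons : ∀ {x y} {u v : Vertex n} → x ≡ y → Adj u v → Adj (x ∷ u) (y ∷ v)
Adj-cons x≡y (i , u≢v , same) = suc i , u≢v ,
  λ { zero _ → x≡y ; (suc k) k≢i → same k (k≢i ∘ cong suc) }

Adj-uncons : ∀ {x y} {u v : Vertex n} → Adj (x ∷ u) (y ∷ v) → (x ≢ y × u ≡ v) ⊎ (x ≡ y × Adj u v)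
Adj-uncons (zero  , x≢y , same) = inj₁ (x≢y , lookup-extensional _ _ (λ k → same (suc k) (λ ())))
Adj-uncons (suc i , u≢v , same) = inj₂ (same zero (λ ()) , i , u≢v , λ k k≢i → same (suc k) (k≢i ∘ Fin.suc-injective))

Adj-irrefl : {v : Vertex n} → ¬ Adj v v
Adj-irrefl (_ , v≢v , _) = v≢v refl

Adj-parity : (u v : Vertex n) → Adj u v → parity u ≡ not (parity v)
Adj-parity []      []      (() , _)
Adj-parity (x ∷ u) (y ∷ v) adj with Adj-uncons adj
... | inj₁ (x≢y , refl) = trans (cong (_xor parity u) (Bool.¬-not x≢y)) (sym (Bool.not-distribˡ-xor y (parity u)))
... | inj₂ (refl , adj′) = trans (cong (x xor_) (Adj-parity u v adj′)) (sym (Bool.not-distribʳ-xor x (parity v)))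

nbhd-sound : (S : VSet n) (v : Vertex n) → v ∈ nbhd S → ∃ λ w → w ∈ S × Adj w v
nbhd-sound S (x ∷ v) v∈ with ∨-split (S (not x ∷ v)) v∈
... | inj₁ opposite = not x ∷ v , opposite , Adj-flip v (Bool.not-¬ refl ∘ sym)
... | inj₂ same with nbhd-sound (slice x S) v same
...   | w , w∈S , adj = x ∷ w , w∈S , Adj-cons refl adj

next-inject₁ : (i : Fin j) → next (inject₁ i) ≡ suc i
next-inject₁ {j} i = Fin.toℕ-injective (trans (Fin.toℕ-fromℕ< (m%n<n (suc (toℕ (inject₁ i))) (suc j)))
  (trans (m<n⇒m%n≡m (s≤s (subst (_< j) (sym (Fin.toℕ-inject₁ i)) (Fin.toℕ<n i))))
    (cong suc (Fin.toℕ-inject₁ i))))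

next-fromℕ : ∀ j → next (fromℕ j) ≡ zero
next-fromℕ j = Fin.toℕ-injective (trans (Fin.toℕ-fromℕ< (m%n<n (suc (toℕ (fromℕ j))) (suc j)))
  (trans (cong (λ k → suc k % suc j) (Fin.toℕ-fromℕ j)) (n%n≡0 (suc j))))
  where open import Data.Nat using (_%_)

prev : Fin (suc j) → Fin (suc j)
prev {j} zero = fromℕ j
prev (suc i)  = inject₁ i

next-prev : (i : Fin (suc j)) → next (prev i) ≡ i
next-prev {j} zero = next-fromℕ j
next-prev (suc i)  = next-inject₁ i

prev-next : (i : Fin (suc j)) → prev (next i) ≡ i
prev-next i with view i
... | ‵fromℕ {j}  = cong prev (next-fromℕ j)
... | ‵inject₁ i′ = cong prev (next-inject₁ i′)

next-injective : {i k : Fin (suc j)} → next i ≡ next k → i ≡ k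
next-injective {i = i} {k} eq = trans (sym (prev-next i)) (trans (cong prev eq) (prev-next k))

module Switch {M : Dimer n} (γ : AltCycle M j) where

  data Position (v : Vertex n) : Set where
    at-a : ∀ i → a γ i ≡ v → Position v
    at-b : ∀ i → b γ i ≡ v → Position v
    off  : ¬ OnCycle γ v → Position v

  position : ∀ v → Position v
  position v with Fin.any? (λ i → b γ i ≟ v)
  ... | yes (i , bi≡v) = at-b i bi≡v
  ... | no ∉b with Fin.any? (λ i → a γ i ≟ v)
  ...   | yes (i , ai≡v) = at-a i ai≡v
  ...   | no ∉a = off λ { (i , inj₁ ai≡v) → ∉a (i , ai≡v) ; (i , inj₂ bi≡v) → ∉b (i , bi≡v) }

  partner-b : ∀ i → partner M (b γ i) ≡ a γ i
  partner-b i = trans (cong (partner M) (sym (dimer γ i))) (partner-inv M (a γ i))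

  move : ∀ {v} → Position v → Vertex n
  move (at-a i _)  = b γ (prev i)
  move (at-b i _)  = a γ (next i)
  move {v} (off _) = partner M v

  move-adj : ∀ {v} (p : Position v) → Adj v (move p)
  move-adj (at-a i refl) = Adj-sym {u = b γ (prev i)} {a γ i} (subst (λ k → Adj (b γ (prev i)) (a γ k)) (next-prev i) (edge γ (prev i)))
  move-adj (at-b i refl) = edge γ i
  move-adj {v} (off _)   = partner-adj M v

  off-partner : ∀ {v} → ¬ OnCycle γ v → ¬ OnCycle γ (partner M v)
  off-partner {v} v∉ (i , inj₁ ai≡) = v∉ (i , inj₂ (trans (sym (dimer γ i)) (trans (cong (partner M) ai≡) (partner-inv M v))))
  off-partner {v} v∉ (i , inj₂ bi≡) = v∉ (i , inj₁ (trans (sym (partner-b i)) (trans (cong (partner M) bi≡) (partner-inv M v))))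

  -- Distinctness on the cycle makes the new partner independent of the witness, so each property of
  -- `switch` can be checked at the most convenient position.
  move-unique : ∀ {v} (p q : Position v) → move p ≡ move q
  move-unique (at-a i refl) (at-a k eq)   = cong (b γ ∘ prev) (sym (a-inj γ k i eq))
  move-unique (at-a i refl) (at-b k eq)   = ⊥-elim (a≢b γ i k (sym eq))
  move-unique (at-b i refl) (at-a k eq)   = ⊥-elim (a≢b γ k i eq)
  move-unique (at-b i refl) (at-b k eq)   = cong (a γ ∘ next) (sym (b-inj γ k i eq))
  move-unique (off _)       (off _)       = refl
  move-unique (off v∉)      (at-a i eq)   = ⊥-elim (v∉ (i , inj₁ eq))
  move-unique (off v∉)      (at-b i eq)   = ⊥-elim (v∉ (i , inj₂ eq))
  move-unique (at-a i eq)   (off v∉)      = ⊥-elim (v∉ (i , inj₁ eq))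
  move-unique (at-b i eq)   (off v∉)      = ⊥-elim (v∉ (i , inj₂ eq))

  move-inv : ∀ {v} (p : Position v) (q : Position (move p)) → move q ≡ v
  move-inv (at-a i refl) q = trans (move-unique q (at-b (prev i) refl)) (cong (a γ) (next-prev i))
  move-inv (at-b i refl) q = trans (move-unique q (at-a (next i) refl)) (cong (b γ) (prev-next i))
  move-inv {v} (off v∉)  q = trans (move-unique q (off (off-partner v∉))) (partner-inv M v)

  switch : Dimer n
  switch .partner v     = move (position v)
  switch .partner-adj v = move-adj (position v)
  switch .partner-inv v = move-inv (position v) (position (move (position v)))

  switch-switched : Switched M γ switch
  switch-switched = (λ i → move-unique (position (b γ i)) (at-b i refl))
    , (λ v v∉ → move-unique (position v) (off v∉))

-- Walks between configurations

StepD-respˡ : {M M′ N : Dimer n} → M ≈D M′ → StepD ℓ M N → StepD ℓ M′ N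
StepD-respˡ M≈M′ (j , 1≤j , j<ℓ , γ , on , off) = j , 1≤j , j<ℓ ,
  record { a = a γ ; b = b γ ; a-inj = a-inj γ ; b-inj = b-inj γ ; a≢b = a≢b γ
         ; dimer = λ i → trans (sym (M≈M′ (a γ i))) (dimer γ i) ; edge = edge γ } ,
  on , λ v v∉ → trans (off v v∉) (M≈M′ v)

-- The same cycle, read from b₀: its edges from bᵢ to the next a are now the dimers, and switching
-- them restores the dimers of `M`.
StepD-sym : {M N : Dimer n} → StepD ℓ M N → StepD ℓ N M
StepD-sym {M = M} {N} (j , 1≤j , j<ℓ , γ , on , off) = j , 1≤j , j<ℓ , reversed ,
  (λ i → dimer γ (next i)) , λ v v∉ → sym (off v (v∉ ∘ on-reversed v))
  where
  reversed : AltCycle N j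
  reversed = record
    { a = b γ
    ; b = a γ ∘ next
    ; a-inj = b-inj γ
    ; b-inj = λ i k eq → next-injective (a-inj γ _ _ eq)
    ; a≢b = λ i k eq → a≢b γ (next k) i (sym eq)
    ; dimer = on
    ; edge = λ i → subst (Adj (a γ (next i))) (dimer γ (next i)) (partner-adj M (a γ (next i)))
    }
  on-reversed : ∀ v → OnCycle γ v → OnCycle reversed v
  on-reversed v (i , inj₁ eq) = prev i , inj₂ (trans (cong (a γ) (next-prev i)) eq)
  on-reversed v (i , inj₂ eq) = i , inj₁ eq

Within-respˡ : {M M′ N : Dimer n} → M ≈D M′ → Within ℓ k M N → Within ℓ k M′ N
Within-respˡ M≈M′ (done M≈N)   = done (λ v → trans (sym (M≈M′ v)) (M≈N v))
Within-respˡ {M = M} {M′} M≈M′ (step {K = K} s rest) = step (StepD-respˡ {M = M} {M′} {K} M≈M′ s) rest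

Within-mono : ∀ {k′} {M N : Dimer n} → k ≤ k′ → Within ℓ k M N → Within ℓ k′ M N
Within-mono _         (done M≈N)    = done M≈N
Within-mono (s≤s k≤k′) (step s rest) = step s (Within-mono k≤k′ rest)

Within-trans : ∀ {k′} {M K N : Dimer n} → Within ℓ k M K → Within ℓ k′ K N → Within ℓ (k + k′) M N
Within-trans {k = k} {k′} {M = M} {K} (done M≈K) rest = Within-mono (m≤n+m k′ k) (Within-respˡ {M = K} {M} (λ v → sym (M≈K v)) rest)
Within-trans (step s rest₁) rest = step s (Within-trans rest₁ rest)

Within-sym : {M N : Dimer n} → Within ℓ k M N → Within ℓ k N M
Within-sym (done M≈N) = done (λ v → sym (M≈N v))
Within-sym {ℓ = ℓ} {k = suc k} {N = N} (step {M = M} {K} s rest) = subst (λ i → Within ℓ i N M) (+-comm k 1)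
  (Within-trans (Within-sym rest) (step {n = 0} {K} {M} {M} (StepD-sym {M = M} {K} s) (done (λ _ → refl))))

-- Gluing two layers

join : (Bool → Dimer n) → Dimer (suc n)
join L .partner (x ∷ v)     = x ∷ partner (L x) v
join L .partner-adj (x ∷ v) = Adj-cons refl (partner-adj (L x) v)
join L .partner-inv (x ∷ v) = cong (x ∷_) (partner-inv (L x) v)

join-step : ∀ {ℓ ℓ′} {L L′ : Bool → Dimer n} x → ℓ ≤ ℓ′ → (∀ y → y ≢ x → L y ≈D L′ y) →
  StepD ℓ (L x) (L′ x) → StepD ℓ′ (join L) (join L′)
join-step {L = L} {L′} x ℓ≤ℓ′ same (j , 1≤j , j<ℓ , γ , on , off) =
  j , 1≤j , ≤-trans j<ℓ ℓ≤ℓ′ , lifted , (λ i → cong (x ∷_) (on i)) , off-lifted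
  where
  lifted : AltCycle (join L) j
  lifted = record
    { a = (x ∷_) ∘ a γ
    ; b = (x ∷_) ∘ b γ
    ; a-inj = λ i k eq → a-inj γ i k (Vec.∷-injectiveʳ eq)
    ; b-inj = λ i k eq → b-inj γ i k (Vec.∷-injectiveʳ eq)
    ; a≢b = λ i k eq → a≢b γ i k (Vec.∷-injectiveʳ eq)
    ; dimer = λ i → cong (x ∷_) (dimer γ i)
    ; edge = λ i → Adj-cons refl (edge γ i)
    }
  off-lifted : ∀ v → ¬ OnCycle lifted v → partner (join L′) v ≡ partner (join L) v
  off-lifted (y ∷ v) v∉ with y Bool.≟ x
  ... | no y≢x = cong (y ∷_) (sym (same y y≢x v))
  ... | yes refl = cong (x ∷_) (off v λ
    { (i , inj₁ eq) → v∉ (i , inj₁ (cong (x ∷_) eq))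
    ; (i , inj₂ eq) → v∉ (i , inj₂ (cong (x ∷_) eq)) })

_⊔_ : Dimer n → Dimer n → Bool → Dimer n
(M ⊔ N) true  = M
(M ⊔ N) false = N

-- One layer is walked to its end while the other rests, then the other, so the lengths add.
join-within : ∀ {ℓ ℓ′} {M M′ N N′ : Dimer n} {k k′} → ℓ ≤ ℓ′ →
  Within ℓ k M M′ → Within ℓ k′ N N′ → Within ℓ′ (k + k′) (join (M ⊔ N)) (join (M′ ⊔ N′))
join-within {k = k} {k′} ℓ≤ℓ′ (done M≈M′) (done N≈N′) =
  done λ { (true ∷ v) → cong (true ∷_) (M≈M′ v) ; (false ∷ v) → cong (false ∷_) (N≈N′ v) }
join-within {ℓ′ = ℓ′} {M} {M′} {N} {N′} {k = k} ℓ≤ℓ′ (done M≈M′) (step {n = k′} {K = K} s rest) =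
  subst (λ i → Within ℓ′ i (join (M ⊔ N)) (join (M′ ⊔ N′))) (sym (+-suc k k′))
    (step (join-step {L = M ⊔ _} {M ⊔ K} false ℓ≤ℓ′ (λ { true _ v → refl ; false ne → ⊥-elim (ne refl) }) s)
          (join-within ℓ≤ℓ′ (done M≈M′) rest))
join-within {N = N} ℓ≤ℓ′ (step {K = K} s rest) other =
  step (join-step {L = _ ⊔ N} {K ⊔ N} true ℓ≤ℓ′ (λ { false _ v → refl ; true ne → ⊥-elim (ne refl) }) s)
       (join-within ℓ≤ℓ′ rest other)

-- Vertical dimers

module ClosedWalk {m} (π π⁻¹ : Vertex (suc m) → Vertex (suc m))
  (π-π⁻¹ : ∀ v → π (π⁻¹ v) ≡ v) (π⁻¹-π : ∀ v → π⁻¹ (π v) ≡ v)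
  (u : Vertex (suc m)) (fixed : π u ≡ u) where

  -- A sequence of distinct black vertices q_0 = x, …, q_len = u with π(q_i) ~ q_(i+1).
  record Path (x : Vertex (suc m)) (len : ℕ) : Set where
    field
      at       : Fin (suc len) → Vertex (suc m)
      start    : at zero ≡ x
      finish   : at (fromℕ len) ≡ u
      linked   : ∀ i → Adj (π (at (inject₁ i))) (at (suc i))
      distinct : ∀ i k → at i ≡ at k → i ≡ k
  open Path public

  Reaches : ℕ → Vertex (suc m) → Set
  Reaches k x = ∃ λ len → len ≤ k × Path x len

  trivial : Reaches 0 u
  trivial = 0 , z≤n , record
    { at = λ _ → u ; start = refl ; finish = refl ; linked = λ ()
    ; distinct = λ { zero zero _ → refl } }

  rest : ∀ {x len} (P : Path x (suc len)) → Path (at P (suc zero)) len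
  rest P = record
    { at = at P ∘ suc ; start = refl ; finish = finish P ; linked = linked P ∘ suc
    ; distinct = λ i k eq → Fin.suc-injective (distinct P (suc i) (suc k) eq) }

  suffix : ∀ {x len} (P : Path x len) i → Reaches len (at P i)
  suffix {len = len} P zero = len , ≤-refl , record
    { at = at P ; start = refl ; finish = finish P ; linked = linked P ; distinct = distinct P }
  suffix {len = suc len} P (suc i) with suffix (rest P) i
  ... | l , l≤len , Q = l , m≤n⇒m≤1+n l≤len , Q

  -- If x already lies on the path, the suffix from x is taken instead: this keeps the points
  -- distinct and does not lengthen the path.
  extend : ∀ {x y k} → Adj (π x) y → Reaches k y → Reaches (suc k) x
  extend {x} {y} {k} adj (len , len≤k , P) with Fin.any? (λ i → at P i ≟ x)
  ... | yes (i , refl) with suffix P i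
  ...   | l , l≤len , Q = l , m≤n⇒m≤1+n (≤-trans l≤len len≤k) , Q
  extend {x} {y} {k} adj (len , len≤k , P) | no x∉P = suc len , s≤s len≤k , record
    { at = at′ ; start = refl ; finish = finish P ; linked = linked′ ; distinct = distinct′ }
    where
    at′ : Fin (suc (suc len)) → Vertex (suc m)
    at′ zero    = x
    at′ (suc i) = at P i
    linked′ : ∀ i → Adj (π (at′ (inject₁ i))) (at′ (suc i))
    linked′ zero    = subst (Adj (π x)) (sym (start P)) adj
    linked′ (suc i) = linked P i
    distinct′ : ∀ i k → at′ i ≡ at′ k → i ≡ k
    distinct′ zero    zero    _  = refl
    distinct′ zero    (suc k) eq = ⊥-elim (x∉P (k , sym eq))
    distinct′ (suc i) zero    eq = ⊥-elim (x∉P (i , eq))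
    distinct′ (suc i) (suc k) eq = cong suc (distinct P i k eq)

  fixed⁻¹ : π⁻¹ u ≡ u
  fixed⁻¹ = trans (cong π⁻¹ (sym fixed)) (π⁻¹-π u)

  π-injective : Injective _≡_ _≡_ π
  π-injective {x} {y} eq = trans (sym (π⁻¹-π x)) (trans (cong π⁻¹ eq) (π⁻¹-π y))

  π⁻¹-injective : Injective _≡_ _≡_ π⁻¹
  π⁻¹-injective {x} {y} eq = trans (sym (π-π⁻¹ x)) (trans (cong π eq) (π-π⁻¹ y))

  -- Both sets record white ends π(q): in `forward`, for q at the end of a walk of k links from u;
  -- in `backward`, for q from which a walk of k links leads to u.
  forward backward : ℕ → VSet (suc m)
  forward zero    = ⁅ u ⁆
  forward (suc k) = nbhd (forward k) ∘ π⁻¹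
  backward zero    = ⁅ u ⁆
  backward (suc k) = nbhd (backward k ∘ π)

  nbhd≤forward : ∀ k → card (nbhd (forward k)) ≤ card (forward (suc k))
  nbhd≤forward k = card-injection (nbhd (forward k)) (forward (suc k)) π π-injective
    (λ v v∈ → trans (cong (nbhd (forward k)) (π⁻¹-π v)) v∈)

  0<partialSum : ∀ j → 0 < partialSum m (suc j)
  0<partialSum zero    = s≤s z≤n
  0<partialSum (suc j) = ≤-trans (0<partialSum j) (m≤m+n _ _)

  -- π is a bijection, so each step grows the set at least as much as taking neighbours does.
  forward-size : ∀ k → partialSum m (suc k) ≤ card (forward k)
  forward-size zero    = ≤-reflexive (sym (card-⁅⁆ u))
  forward-size (suc k) = ≤-trans
    (nbhd-growth (forward k) (≤-trans (0<partialSum k) (forward-size k)) (suc k) (forward-size k))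
    (nbhd≤forward k)

  backward-size : ∀ k → partialSum m (suc k) ≤ card (backward k)
  backward-size zero    = ≤-reflexive (sym (card-⁅⁆ u))
  backward-size (suc k) = nbhd-growth (backward k ∘ π) (≤-trans (0<partialSum k) size) (suc k) size
    where
    size : partialSum m (suc k) ≤ card (backward k ∘ π)
    size = ≤-trans (backward-size k)
      (card-injection (backward k) (backward k ∘ π) π⁻¹ π⁻¹-injective
        (λ v v∈ → trans (cong (backward k) (π-π⁻¹ v)) v∈))

  backward-reaches : ∀ k w → w ∈ backward k → Reaches k (π⁻¹ w)
  backward-reaches zero w w∈ with decided (w ≟ u) w∈
  ... | refl = subst (Reaches 0) (sym fixed⁻¹) trivial
  backward-reaches (suc k) w w∈ with nbhd-sound (backward k ∘ π) w w∈
  ... | q , πq∈ , adj = extend (subst (λ z → Adj z q) (sym (π-π⁻¹ w)) (Adj-sym {u = q} {w} adj))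
    (subst (Reaches k) (π⁻¹-π q) (backward-reaches k (π q) πq∈))

  -- As π(u) = u, the edge from u to x closes the path into a cyclic sequence of at most k+1 points.
  Closed : ℕ → Set
  Closed k = ∃ λ x → Adj u x × Reaches k x

  -- Membership in `forward` is unwound one predecessor at a time, each prolonging the path at its
  -- front, until the predecessor is u. That last edge is the closing one, so it is not counted in
  -- k.
  close : ∀ k {i} w → w ∈ forward (suc k) → Reaches i (π⁻¹ w) → Closed (k + i)
  close k w w∈ path with nbhd-sound (forward k) (π⁻¹ w) w∈
  close zero w w∈ path | p , p∈ , adj with decided (p ≟ u) p∈
  ... | refl = π⁻¹ w , adj , path
  close (suc k) {i} w w∈ path | p , p∈ , adj = subst Closed (+-suc k i)
    (close k p p∈ (extend (subst (λ z → Adj z (π⁻¹ w)) (sym (π-π⁻¹ p)) adj) path))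

  close-at-u : ∀ k → u ∈ forward (suc k) → Closed k
  close-at-u k u∈ = subst Closed (+-identityʳ k)
    (close k u u∈ (subst (Reaches 0) (sym fixed⁻¹) trivial))

  Closed-mono : ∀ {k k′} → k ≤ k′ → Closed k → Closed k′
  Closed-mono k≤k′ (x , adj , len , len≤k , P) = x , adj , len , ≤-trans len≤k k≤k′ , P

  half-forward : ∀ k → 2 ^ m ≤ partialSum m (suc (m + k))
  half-forward zero = ≤-reflexive (trans (sym (partialSum-full m)) (cong (partialSum m ∘ suc) (sym (+-identityʳ m))))
  half-forward (suc k) = ≤-trans (half-forward k)
    (≤-trans (m≤m+n _ _) (≤-reflexive (cong (partialSum m ∘ suc) (sym (+-suc m k)))))

  closed : Closed (suc m + m)
  closed with meet? (forward (suc (suc m))) (backward m)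
  -- Here (m+1)+m links make a cyclic sequence of at most 2(m+1) points.
  ... | inj₁ (w , w∈F , w∈B) = close (suc m) w w∈F (backward-reaches m w w∈B)
  -- Disjointness from `backward m`, of size at least 2^m, leaves at most 2^m points for
  -- `forward (m+2)`. As `forward (m+1)` already has that many, its neighbourhood is no larger, and
  -- it is a union of parity classes.
  ... | inj₂ apart with nbhd-equality (forward (suc m)) stagnant
    where
    stagnant : card (nbhd (forward (suc m))) ≤ card (forward (suc m))
    stagnant = +-cancelʳ-≤ (2 ^ m) _ _ (begin
      card (nbhd (forward (suc m))) + 2 ^ m
        ≤⟨ +-mono-≤ (nbhd≤forward (suc m)) (≤-trans (≤-reflexive (sym (partialSum-full m))) (backward-size m)) ⟩
      card (forward (suc (suc m))) + card (backward m)
        ≤⟨ apart ⟩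
      2 ^ suc m
        ≡⟨ cong (2 ^ m +_) (+-identityʳ (2 ^ m)) ⟩
      2 ^ m + 2 ^ m
        ≤⟨ +-monoˡ-≤ (2 ^ m) (≤-trans (half-forward 1)
             (≤-trans (≤-reflexive (cong (partialSum m ∘ suc) (+-comm m 1))) (forward-size (suc m)))) ⟩
      card (forward (suc m)) + 2 ^ m ∎)
      where open ≤-Reasoning
  ...   | h , on-F , on-N with h (not (parity u)) in hu
  -- The neighbourhood contains the parity class of u, so u returns to itself.
  ...     | true = Closed-mono (s≤s (m≤m+n m m))
    (close-at-u (suc m) (trans (cong (nbhd (forward (suc m))) fixed⁻¹) (trans (on-N u) hu)))
  -- The class opposite to u is missing from `forward (m+1)`, so its points, of which there is one,
  -- share the parity of u, and u is among them.
  ...     | false with 0<card⇒inhabited (forward (suc m)) (≤-trans (0<partialSum (suc m)) (forward-size (suc m)))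
  ...       | v , v∈ with parity v Bool.≟ parity u
  ...         | yes same = Closed-mono (m≤n⇒m≤1+n (m≤m+n m m))
    (close-at-u m (trans (on-F u) (trans (cong h (sym same)) (trans (sym (on-F v)) v∈))))
  ...         | no differ = true-false v∈ (trans (on-F v) (trans (cong h (Bool.¬-not differ)) hu))

-- The permutation of a configuration

white black : Vertex n → Vertex (suc n)
white v = parity v ∷ v
black v = not (parity v) ∷ v

white-parity : (v : Vertex n) → parity (white v) ≡ false
white-parity v = Bool.xor-same (parity v)

black-parity : (v : Vertex n) → parity (black v) ≡ true
black-parity v = trans (sym (Bool.not-distribˡ-xor (parity v) (parity v))) (cong not (white-parity v))

white≢black : {v w : Vertex n} → white v ≢ black w
white≢black {v = v} {w} eq = true-false (trans (cong parity eq) (black-parity w)) (white-parity v)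

xor-false : ∀ x y → x xor y ≡ false → x ≡ y
xor-false true  y e = sym (trans (sym (Bool.not-involutive y)) (cong not e))
xor-false false y e = sym e

xor-true : ∀ x y → x xor y ≡ true → x ≡ not y
xor-true true  y e = sym e
xor-true false y e = sym (cong not e)

white-tail : (u : Vertex (suc n)) → parity u ≡ false → u ≡ white (tail u)
white-tail (x ∷ v) e = cong (_∷ v) (xor-false x (parity v) e)

black-tail : (u : Vertex (suc n)) → parity u ≡ true → u ≡ black (tail u)
black-tail (x ∷ v) e = cong (_∷ v) (xor-true x (parity v) e)

module _ (M : Dimer (suc n)) where

  π π⁻¹ : Vertex n → Vertex n
  π v   = tail (partner M (black v))
  π⁻¹ v = tail (partner M (white v))

  partner-black : ∀ v → partner M (black v) ≡ white (π v)
  partner-black v = white-tail _ (trans (sym (Bool.not-involutive _))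
    (cong not (trans (sym (Adj-parity (black v) (partner M (black v)) (partner-adj M (black v)))) (black-parity v))))

  partner-white : ∀ v → partner M (white v) ≡ black (π⁻¹ v)
  partner-white v = black-tail _ (trans (sym (Bool.not-involutive _))
    (cong not (trans (sym (Adj-parity (white v) (partner M (white v)) (partner-adj M (white v)))) (white-parity v))))

  partner-white-π : ∀ v → partner M (white (π v)) ≡ black v
  partner-white-π v = trans (cong (partner M) (sym (partner-black v))) (partner-inv M (black v))

  π-π⁻¹ : ∀ v → π (π⁻¹ v) ≡ v
  π-π⁻¹ v = cong tail (trans (cong (partner M) (sym (partner-white v))) (partner-inv M (white v)))

  π⁻¹-π : ∀ v → π⁻¹ (π v) ≡ v
  π⁻¹-π v = cong tail (partner-white-π v)

  π-inj : Injective _≡_ _≡_ π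
  π-inj {x} {y} eq = trans (sym (π⁻¹-π x)) (trans (cong π⁻¹ eq) (π⁻¹-π y))

  π-adj : ∀ v → π v ≢ v → Adj v (π v)
  π-adj v πv≢v with Adj-uncons (subst (Adj (black v)) (partner-black v) (partner-adj M (black v)))
  ... | inj₁ (_ , v≡πv) = ⊥-elim (πv≢v (sym v≡πv))
  ... | inj₂ (_ , adj) = adj

  -- These are the vertical dimers over odd points, whose black end has first coordinate `false`.
  up : VSet n
  up v = does (π v ≟ v) ∧ parity v

  ∈-up : ∀ {v} → π v ≡ v → parity v ≡ true → v ∈ up
  ∈-up {v} πv≡v pv rewrite dec-true (π v ≟ v) πv≡v = pv

  up-fixed : ∀ {v} → v ∈ up → π v ≡ v
  up-fixed {v} v∈ = decided (π v ≟ v) (proj₁ (∧-split (does (π v ≟ v)) v∈))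

  up-parity : ∀ {v} → v ∈ up → parity v ≡ true
  up-parity {v} v∈ = proj₂ (∧-split (does (π v ≟ v)) v∈)

remove-up : (M : Dimer (suc (suc m))) → ∀ {u} → u ∈ up M →
  ∃ λ K → StepD (2 * suc m) M K × card (up K) < card (up M)
remove-up {m} M {u} u∈ with ClosedWalk.closed (π M) (π⁻¹ M) (π-π⁻¹ M) (π⁻¹-π M) u (up-fixed M u∈)
... | x , adj , len , len≤ , P = K ,
    (len , nontrivial len P , ≤-trans (s≤s len≤) (≤-reflexive (double m)) , γ , switched) ,
    card-strict (up K) (up M) up-K⊆ u∉ u∈
  where
  open ClosedWalk (π M) (π⁻¹ M) (π-π⁻¹ M) (π⁻¹-π M) u (up-fixed M u∈) using (Path; at; start; finish; linked; distinct)

  double : ∀ m → suc (suc m + m) ≡ 2 * suc m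
  double = solve-∀

  nontrivial : ∀ len → Path x len → 1 ≤ len
  nontrivial zero P = ⊥-elim (Adj-irrefl {v = u} (subst (Adj u) (trans (sym (start P)) (finish P)) adj))
  nontrivial (suc _) _ = s≤s z≤n

  q : Fin (suc len) → Vertex (suc m)
  q = at P

  turn : ∀ i → Adj (π M (q i)) (q (next i))
  turn i with view i
  ... | ‵fromℕ = subst₂ Adj (sym (trans (cong (π M) (finish P)) (up-fixed M u∈)))
                   (trans (sym (start P)) (cong q (sym (next-fromℕ len)))) adj
  ... | ‵inject₁ k = subst (λ z → Adj (π M (q (inject₁ k))) (q z)) (sym (next-inject₁ k)) (linked P k)

  γ : AltCycle M len
  γ = record
    { a = black ∘ q
    ; b = white ∘ π M ∘ q
    ; a-inj = λ i k eq → distinct P i k (cong tail eq)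
    ; b-inj = λ i k eq → distinct P i k (π-inj M (cong tail eq))
    ; a≢b = λ i k eq → white≢black (sym eq)
    ; dimer = λ i → partner-black M (q i)
    -- Adjacent points have opposite parities, so their white and black lifts share the first
    -- coordinate: the edge is not vertical.
    ; edge = λ i → Adj-cons (Adj-parity (π M (q i)) (q (next i)) (turn i)) (turn i)
    }

  K : Dimer (suc (suc m))
  K = Switch.switch γ

  switched : Switched M γ K
  switched = Switch.switch-switched γ

  partner-white-fixed : ∀ {v} → π K v ≡ v → partner K (white v) ≡ black v
  partner-white-fixed {v} eq = trans (cong (partner K ∘ white) (sym eq)) (partner-white-π K v)

  -- After switching, the white lift of π(q_i) is matched to the black lift of a neighbour of
  -- π(q_i), not of π(q_i) itself.
  moved : ∀ i → π K (π M (q i)) ≢ π M (q i)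
  moved i eq = Adj-irrefl {v = π M (q i)} (subst (Adj (π M (q i)))
    (cong tail (trans (sym (proj₁ switched i)) (partner-white-fixed eq))) (turn i))

  -- By `moved`, a fixed point v of `K` has its white lift off the cycle, where `K` and `M` agree.
  up-K⊆ : up K ⊆ up M
  up-K⊆ v v∈ with Switch.position γ (white v)
  ... | Switch.at-a i eq = ⊥-elim (white≢black (sym eq))
  ... | Switch.at-b i eq = ⊥-elim (moved i (subst (λ z → π K z ≡ z) (sym (cong tail eq)) (up-fixed K v∈)))
  ... | Switch.off v∉ = ∈-up M (trans (cong (π M) (sym π⁻¹v≡v)) (π-π⁻¹ M v)) (up-parity K v∈)
    where
    π⁻¹v≡v : π⁻¹ M v ≡ v
    π⁻¹v≡v = cong tail (trans (sym (proj₂ switched (white v) v∉)) (partner-white-fixed (up-fixed K v∈)))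

  u∉ : u ∉ up K
  u∉ with up K u in eq
  ... | false = refl
  ... | true = ⊥-elim (moved (fromℕ len) (subst (λ z → π K z ≡ z)
    (sym (trans (cong (π M) (finish P)) (up-fixed M u∈))) (up-fixed K eq)))

remove-all-up : ∀ k (M : Dimer (suc (suc m))) → card (up M) ≤ k →
  ∃ λ K → Within (2 * suc m) k M K × (∀ v → v ∉ up K)
remove-all-up k M le with inhabited? (up M)
... | inj₂ none = M , done (λ _ → refl) , none
remove-all-up zero M le | inj₁ (u , u∈) = ⊥-elim (<⇒≱ (inhabited⇒0<card (up M) u∈) le)
remove-all-up (suc k) M le | inj₁ (u , u∈) =
  let K  , s    , fewer = remove-up M u∈
      K′ , walk , none  = remove-all-up k K (≤-pred (≤-trans fewer le))
  in K′ , step s walk , none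

card-complement : (S : VSet n) → card S + card (not ∘ S) ≡ 2 ^ n
card-complement {zero} S with S []
... | true  = refl
... | false = refl
card-complement {suc n} S = trans
  (+-interchange (card (slice true S)) _ (card (slice true (not ∘ S))) _)
  (cong₂ _+_ (card-complement (slice true S))
    (trans (card-complement (slice false S)) (sym (+-identityʳ (2 ^ n)))))

card-odd : ∀ n → card (parity {suc n}) ≡ 2 ^ n
card-odd n = trans (+-comm (card (not ∘ parity {n})) _) (card-complement (parity {n}))

card-even : ∀ n → card (not ∘ parity {suc n}) ≡ 2 ^ n
card-even n = +-cancelˡ-≡ (2 ^ n) _ _ (trans (cong (_+ card (not ∘ parity {suc n})) (sym (card-odd n)))
  (trans (card-complement (parity {suc n})) (cong (2 ^ n +_) (+-identityʳ (2 ^ n)))))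

no-up⇒no-fixed : (M : Dimer (suc (suc m))) → (∀ v → v ∉ up M) → ∀ v → π M v ≢ v
no-up⇒no-fixed {m} M none v πv≡v with parity v Bool.≟ true
... | yes odd = true-false (∈-up M {v} πv≡v odd) (none v)
-- Pigeonhole: π would inject the odd points into the even points other than v, which is its own
-- preimage, yet the two classes have equal size.
... | no ¬odd = <⇒≱
    (card-strict (even ∖ v) even (∖-⊆ even v) {v} (∉-∖ even v) (cong not v-even))
    (≤-trans (≤-reflexive (trans (card-even m) (sym (card-odd m))))
      (card-injection parity (even ∖ v) (π M) (π-inj M) maps))
  where
  even : VSet (suc m)
  even = not ∘ parity
  v-even : parity v ≡ false
  v-even = Bool.¬-not ¬odd
  maps : ∀ w → w ∈ parity → π M w ∈ (even ∖ v)
  maps w odd = ∈-∖ even {v} {π M w}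
    (trans (sym (Adj-parity w (π M w) (π-adj M w (λ πw≡w → true-false (∈-up M {w} πw≡w odd) (none w))))) odd)
    (λ πw≡v → true-false odd (trans (cong parity (π-inj M (trans πw≡v (sym πv≡v)))) v-even))

-- Induction on the dimension

Flat : Dimer (suc n) → Set
Flat M = ∀ x v → partner M (x ∷ v) ≡ x ∷ tail (partner M (x ∷ v))

no-fixed⇒flat : (M : Dimer (suc n)) → (∀ v → π M v ≢ v) → Flat M
-- The vertex x ∷ v is the white or the black lift of v; a vertical dimer at either would fix v.
no-fixed⇒flat M moves x v with x Bool.≟ parity v
... | yes refl with Adj-uncons (subst (Adj (white v)) (partner-white M v) (partner-adj M (white v)))
...   | inj₁ (_ , v≡) = ⊥-elim (moves v (trans (cong (π M) v≡) (π-π⁻¹ M v)))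
...   | inj₂ (eq , _) = trans (partner-white M v) (cong (_∷ π⁻¹ M v) (sym eq))
no-fixed⇒flat M moves x v | no x≢ with Bool.¬-not x≢
... | refl with Adj-uncons (subst (Adj (black v)) (partner-black M v) (partner-adj M (black v)))
...   | inj₁ (_ , v≡) = ⊥-elim (moves v (sym v≡))
...   | inj₂ (eq , _) = trans (partner-black M v) (cong (_∷ π M v) (sym eq))

layer : (M : Dimer (suc n)) → Flat M → Bool → Dimer n
layer M flat x .partner v = tail (partner M (x ∷ v))
layer M flat x .partner-adj v with Adj-uncons (subst (Adj (x ∷ v)) (flat x v) (partner-adj M (x ∷ v)))
... | inj₁ (x≢x , _) = ⊥-elim (x≢x refl)
... | inj₂ (_ , adj) = adj
layer M flat x .partner-inv v = cong tail
  (trans (cong (partner M) (sym (flat x v))) (partner-inv M (x ∷ v)))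

≈-join-layers : (M : Dimer (suc n)) (flat : Flat M) → M ≈D join (layer M flat true ⊔ layer M flat false)
≈-join-layers M flat (true  ∷ v) = flat true v
≈-join-layers M flat (false ∷ v) = flat false v

clear : (M : Dimer (suc (suc m))) → ∃ λ K → Within (2 * suc m) (2 ^ m) M K × Flat K
clear {m} M =
  let K , walk , none = remove-all-up (2 ^ m) M few
  in K , walk , no-fixed⇒flat K (no-up⇒no-fixed K none)
  where
  few : card (up M) ≤ 2 ^ m
  few = ≤-trans (card-mono (up M) parity (λ v → up-parity M)) (≤-reflexive (card-odd m))

edge-unique : (v w w′ : Vertex 1) → Adj v w → Adj v w′ → w ≡ w′
edge-unique (x ∷ []) (y ∷ []) (z ∷ []) p q with Adj-uncons p | Adj-uncons q
... | inj₁ (x≢y , _) | inj₁ (x≢z , _) = cong (_∷ []) (Bool.not-injective (trans (sym (Bool.¬-not x≢y)) (Bool.¬-not x≢z)))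
... | inj₂ (_ , () , _) | _
... | _ | inj₂ (_ , () , _)

-- Here n = d-1, and the induction starts at d = 1, where only one configuration exists. The walk
-- clears `M`, treats the two layers, and undoes the clearing of `N`.
connected : ∀ n (M N : Dimer (suc n)) → Within (2 * n) (n * 2 ^ n) M N
connected zero M N = done (λ v → edge-unique v _ _ (partner-adj M v) (partner-adj N v))
connected (suc m) M N =
  let M′ , walkM , flatM = clear M
      N′ , walkN , flatN = clear N
      M″ = join (layers M′ flatM)
      N″ = join (layers N′ flatN)
  in subst (λ k → Within (2 * suc m) k M N) (total m (2 ^ m))
    (Within-trans walkM
      (Within-trans
        (Within-respˡ {M = M″} {M′} (λ v → sym (≈-join-layers M′ flatM v))
          (Within-respʳ {M = N″} {N′} (λ v → sym (≈-join-layers N′ flatN v))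
            (join-within (*-monoʳ-≤ 2 (n≤1+n m)) (connected m _ _) (connected m _ _))))
        (Within-sym walkN)))
  where
  layers : (K : Dimer (suc (suc m))) → Flat K → Bool → Dimer (suc m)
  layers K flat = layer K flat true ⊔ layer K flat false
  Within-respʳ : ∀ {ℓ k} {M N K : Dimer (suc (suc m))} → M ≈D N → Within ℓ k K M → Within ℓ k K N
  Within-respʳ {M = M} {N} M≈N w = Within-sym (Within-respˡ {M = M} {N} M≈N (Within-sym w))
  total : ∀ m p → p + ((m * p + m * p) + p) ≡ suc m * (2 * p)
  total = solve-∀

theorem1p6 : (d : ℕ) → 2 ≤ d → (M N : Dimer d) →
    Within (2 * d ∸ 2) ((d ∸ 1) * 2 ^ (d ∸ 1)) M N
theorem1p6 (suc n) _ M N = subst (λ ℓ → Within ℓ (n * 2 ^ n) M N)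
  (sym (trans (cong (_∸ 2) (*-suc 2 n)) (m+n∸m≡n 2 (2 * n)))) (connected n M N)
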